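{- Let $\mathbb{F}$ be a field of characteristic different from $2$ and let $G$ be a connected graph containing no cycle of even length. Then $mr^{ - }(\mathbb{F},G)=2\,match(G)=MR^{ - }(\mathbb{F},G)$.
   Context: All graphs are finite and simple. For a field $\mathbb{F}$ and a graph $G$ on vertices $v_1,\dots,v_n$, $S^{ - }(\mathbb{F},G)$ is the set of skew-symmetric matrices $A\in\mathbb{F}^{n\times n}$ ($A^T=-A$) such that for $i\neq j$, $a_{ij}\neq0$ iff $v_iv_j$ is an edge of $G$. $mr^{ - }(\mathbb{F},G)=\min\{\operatorname{rank}A: A\in S^{ - }(\mathbb{F},G)\}$ and $MR^{ - }(\mathbb{F},G)=\max\{\operatorname{rank}A: A\in S^{ - }(\mathbb{F},G)\}$. $match(G)$ is the matching number of $G$ (maximum number of pairwise disjoint edges). -}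

module Defs where

open import Level using (Level; _⊔_)
open import Algebra.Bundles using (CommutativeRing)
import Algebra.Definitions.RawMonoid as RawMonoidDefs
import Data.Nat as ℕ
open import Data.Nat using (ℕ; _≤_)
open import Data.Nat.Divisibility using (_∣_)
open import Data.Fin using (Fin; zero; suc; inject₁; fromℕ)
open import Data.Bool using (Bool; true; false)
open import Data.Product using (Σ; _×_; _,_; ∃)
open import Data.Sum using (_⊎_; inj₁; inj₂; [_,_])
open import Function.Definitions using (Injective)
open import Relation.Binary.PropositionalEquality using (_≡_; _≢_)
open import Relation.Nullary using (¬_)

record Field (c ℓ : Level) : Set (Level.suc (c ⊔ ℓ)) where
  field
    commutativeRing : CommutativeRing c ℓ
  open CommutativeRing commutativeRing public
  field
    1≉0     : ¬ (1# ≈ 0#)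
    inverse : ∀ x → ¬ (x ≈ 0#) → Σ Carrier λ y → (x * y) ≈ 1#

CharNot2 : ∀ {c ℓ} → Field c ℓ → Set ℓ
CharNot2 F = ¬ ((1# + 1#) ≈ 0#)
  where open Field F

record Graph : Set where
  field
    n     : ℕ
    adj   : Fin n → Fin n → Bool
    sym   : ∀ i j → adj i j ≡ adj j i
    irrefl : ∀ i → adj i i ≡ false

module _ (G : Graph) where
  open Graph G

  Edge : Fin n → Fin n → Set
  Edge i j = adj i j ≡ true

  data Walk : Fin n → Fin n → Set where
    here : ∀ {i} → Walk i i
    step : ∀ {i j k} → Edge i j → Walk j k → Walk i k

  Connected : Set
  Connected = ∀ i j → Walk i j

  IsCycle : (m : ℕ) → (Fin (3 ℕ.+ m) → Fin n) → Set
  IsCycle m v =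
    Injective _≡_ _≡_ v ×
    (∀ (i : Fin (2 ℕ.+ m)) → Edge (v (inject₁ i)) (v (suc i))) ×
    Edge (v (fromℕ (2 ℕ.+ m))) (v zero)

  NoEvenCycle : Set
  NoEvenCycle = ∀ m (v : Fin (3 ℕ.+ m) → Fin n) → IsCycle m v → ¬ (2 ∣ (3 ℕ.+ m))

  HasMatching : ℕ → Set
  HasMatching k = Σ (Fin k → Fin n) λ p → Σ (Fin k → Fin n) λ q →
    (∀ t → Edge (p t) (q t)) × Injective _≡_ _≡_ [ p , q ]

  IsMatchingNumber : ℕ → Set
  IsMatchingNumber k = HasMatching k × (∀ m → HasMatching m → m ≤ k)

module _ {c ℓ} (F : Field c ℓ) where
  open Field F
  open RawMonoidDefs +-rawMonoid using (sum)

  Matrix : ℕ → Set c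
  Matrix n = Fin n → Fin n → Carrier

  LinIndepCols : ∀ {n r} → Matrix n → (Fin r → Fin n) → Set (c ⊔ ℓ)
  LinIndepCols {n} {r} A col =
    ∀ (x : Fin r → Carrier) →
      (∀ (row : Fin n) → sum (λ t → A row (col t) * x t) ≈ 0#) →
      ∀ t → x t ≈ 0#

  HasRank : ∀ {n} → Matrix n → ℕ → Set (c ⊔ ℓ)
  HasRank {n} A r =
    (Σ (Fin r → Fin n) λ col → Injective _≡_ _≡_ col × LinIndepCols A col) ×
    (∀ (col : Fin (ℕ.suc r) → Fin n) → Injective _≡_ _≡_ col → ¬ LinIndepCols A col)

  InSminus : (G : Graph) → Matrix (Graph.n G) → Set ℓ
  InSminus G A =
    (∀ i j → A i j ≈ - A j i) ×
    (∀ i j → i ≢ j → ((¬ (A i j ≈ 0#)) → Edge G i j) × (Edge G i j → ¬ (A i j ≈ 0#)))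

  IsMinRank : Graph → ℕ → Set (c ⊔ ℓ)
  IsMinRank G m =
    (Σ (Matrix (Graph.n G)) λ A → InSminus G A × HasRank A m) ×
    (∀ A r → InSminus G A → HasRank A r → m ≤ r)

  IsMaxRank : Graph → ℕ → Set (c ⊔ ℓ)
  IsMaxRank G M =
    (Σ (Matrix (Graph.n G)) λ A → InSminus G A × HasRank A M) ×
    (∀ A r → InSminus G A → HasRank A r → r ≤ M)

{-# OPTIONS --safe #-}
-- Expanding a Pfaffian along its first index shows that a Pfaffian without a perfect matching on its
-- index list vanishes.  If I lists the ends of a maximum matching, then Pf(j, i, I) = 0 for all j and i.
-- If moreover Pf(I) ≠ 0, then by Cramer's rule the columns in I are independent, and the
-- relations Pf(j, i, I) = 0 say that they span all columns.
-- Two perfect matchings on I that differ contain an alternating closed walk, i.e. an even cycle; hence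
-- the perfect matching on I is unique, Pf(I) is up to sign a product of nonzero entries, and Pf(I) ≠ 0.
--
-- Equality of scalars is undecidable, and the entries off the edges are only ¬¬-zero; finitely
-- many double negations are removed at once when the goal is a negation.
module Submission where

open import Defs
open import Level using (Level; _⊔_)
import Algebra.Definitions.RawMonoid as RawMonoidDefs
import Algebra.Properties.Ring as RingProperties
import Algebra.Properties.Semiring.Sum as SemiringSum
import Algebra.Solver.Ring.NaturalCoefficients.Default as SemiringSolver
open import Data.Bool as Bool using (true; if_then_else_; false)
open import Data.Fin as Fin using (Fin; zero; suc; toℕ; fromℕ; fromℕ<; inject₁; punchIn; punchOut; _≟_)
open import Data.Fin.Properties as Fin
  using (toℕ-injective; toℕ-inject₁; toℕ-fromℕ; toℕ<n; toℕ-fromℕ<; pigeonhole; suc-injective; punchIn-punchOut)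
open import Data.List using (List; []; _∷_; length; lookup; _++_)
open import Data.List.Membership.DecPropositional using () renaming (_∈?_ to mem?)
open import Data.List.Membership.Propositional using (_∈_; _∉_)
open import Data.List.Membership.Propositional.Properties using (∈-∃++; ∈-lookup; ∈-++⁺ʳ)
open import Data.List.Relation.Binary.Permutation.Propositional as Perm
  using (_↭_; ↭⇒↭ₛ; ↭-sym; ↭-refl; ↭-trans; ↭-reflexive; prep; swap)
open import Data.List.Relation.Binary.Permutation.Propositional.Properties using (∈-resp-↭; ↭-length; shift)
import Data.List.Relation.Binary.Permutation.Setoid.Properties as Permₛ
open import Data.List.Relation.Unary.All as All using (All; []; _∷_)
open import Data.List.Relation.Unary.AllPairs using ([]; _∷_; allPairs?)
open import Data.List.Relation.Unary.Any using (here; there)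
open import Data.List.Relation.Unary.Unique.Propositional using (Unique)
open import Data.Nat using (ℕ; zero; suc; _+_; _*_; _≤_; _<_; s≤s; z≤n)
open import Data.Nat.Divisibility using (divides)
import Data.Nat.Properties as ℕ
open import Data.Product using (Σ; _×_; _,_; proj₁; proj₂; ∃)
open import Data.Sum using (_⊎_; inj₁; inj₂; [_,_])
import Data.Sum.Properties as Sum
open import Data.Vec.Functional using () renaming (_∷_ to _◂_)
open import Function using (_∘_; case_of_)
open import Function.Definitions using (Injective)
open import Relation.Binary.Definitions using (tri<; tri≈; tri>)
open import Relation.Binary.PropositionalEquality as ≡
  using (_≡_; _≢_; refl; subst; subst₂; cong; module ≡-Reasoning)
import Relation.Binary.Reasoning.Setoid as SetoidReasoning
open import Relation.Nullary
  using (Dec; ¬_; ¬?; yes; no; _×-dec_; _→-dec_; contradiction; decidable-stable)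
open import Relation.Nullary.Decidable using (map′)

-- Linear algebra over a field with undecidable equality

-- Double negation passes through a finite product by collecting the witnesses one index at a time.
¬¬-Π : ∀ {p} m {P : Fin m → Set p} → (∀ i → ¬ ¬ P i) → ¬ ¬ (∀ i → P i)
¬¬-Π zero    nn k = k λ ()
¬¬-Π (suc m) nn k = nn zero λ p₀ → ¬¬-Π m (nn ∘ suc) λ p → k λ { zero → p₀ ; (suc i) → p i }

module LinearAlgebra {c ℓ} (F : Field c ℓ) where
  open Field F hiding (zero; _+_; _*_; refl)
  open Field F using () renaming (_+_ to infixl 6 _⊕_; _*_ to infixl 7 _⊛_; refl to ≈-refl)
  open RawMonoidDefs +-rawMonoid using (sum)
  open SemiringSum semiring using (sum-cong-≋; *-distribˡ-sum)
  open RingProperties ring using (-‿distribˡ-*; -‿distribʳ-*)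
  open SetoidReasoning setoid
  open SemiringSolver commutativeSemiring using (solve; _:=_; _:+_; _:*_; con)

  cancel-nonzero : ∀ {x y} → ¬ (x ≈ 0#) → x ⊛ y ≈ 0# → y ≈ 0#
  cancel-nonzero {x} {y} x≉0 xy≈0 with inverse x x≉0
  ... | x⁻¹ , xx⁻¹≈1 = begin
    y               ≈⟨ *-identityˡ y ⟨
    1# ⊛ y          ≈⟨ *-congʳ xx⁻¹≈1 ⟨
    (x ⊛ x⁻¹) ⊛ y   ≈⟨ solve 3 (λ a b d → (a :* b) :* d := b :* (a :* d)) ≈-refl x x⁻¹ y ⟩
    x⁻¹ ⊛ (x ⊛ y)   ≈⟨ *-congˡ xy≈0 ⟩
    x⁻¹ ⊛ 0#        ≈⟨ zeroʳ x⁻¹ ⟩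
    0#              ∎

  ⊛-nonzero : ∀ {x y} → ¬ (x ≈ 0#) → ¬ (y ≈ 0#) → ¬ (x ⊛ y ≈ 0#)
  ⊛-nonzero x≉0 y≉0 = y≉0 ∘ cancel-nonzero x≉0

  sum-zero : ∀ {m} (f : Fin m → Carrier) → (∀ i → f i ≈ 0#) → sum f ≈ 0#
  sum-zero {zero}  f f≈0 = ≈-refl
  sum-zero {suc m} f f≈0 = trans (+-cong (f≈0 zero) (sum-zero (f ∘ suc) (f≈0 ∘ suc))) (+-identityˡ 0#)

  sum-linear : ∀ {m} a b (f g z : Fin m → Carrier) →
    sum (λ s → (a ⊛ f s ⊕ b ⊛ g s) ⊛ z s) ≈ a ⊛ sum (λ s → f s ⊛ z s) ⊕ b ⊛ sum (λ s → g s ⊛ z s)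
  sum-linear {zero}  a b f g z = solve 2 (λ a b → con 0 := a :* con 0 :+ b :* con 0) ≈-refl a b
  sum-linear {suc m} a b f g z = trans (+-congˡ (sum-linear a b (f ∘ suc) (g ∘ suc) (z ∘ suc)))
    (solve 7 (λ a b f g z S T → (a :* f :+ b :* g) :* z :+ (a :* S :+ b :* T)
                             := a :* (f :* z :+ S) :+ b :* (g :* z :+ T))
       ≈-refl a b (f zero) (g zero) (z zero) _ _)

  TrivialKernel : ∀ {m k} → (Fin m → Fin k → Carrier) → Set (c ⊔ ℓ)
  TrivialKernel {m} {k} C =
    ∀ (z : Fin k → Carrier) → (∀ t → sum (λ s → C t s ⊛ z s) ≈ 0#) → ∀ s → z s ≈ 0#

  -- Gaussian elimination; equality of scalars is not decidable, so the search for a pivot in the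
  -- first column is only available because the conclusion is a negation.
  wide-kernel : ∀ m (C : Fin m → Fin (suc m) → Carrier) → ¬ TrivialKernel C
  wide-kernel zero    C triv = 1≉0 (triv (λ _ → 1#) (λ ()) zero)
  wide-kernel (suc m) C triv = ¬¬-Π (suc m) {λ t → C t zero ≈ 0#} pivot zero-column
    where
    zero-column : ¬ (∀ t → C t zero ≈ 0#)
    zero-column C₀≈0 = 1≉0 (triv (1# ◂ λ _ → 0#) kernel zero)
      where
      kernel : ∀ t → sum (λ s → C t s ⊛ (1# ◂ λ _ → 0#) s) ≈ 0#
      kernel t = sum-zero (λ s → C t s ⊛ (1# ◂ λ _ → 0#) s) λ
        { zero    → trans (*-identityʳ _) (C₀≈0 t)
        ; (suc s) → zeroʳ _ }

    pivot : ∀ t₀ → ¬ ¬ (C t₀ zero ≈ 0#)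
    -- A vector killed by `reduced` lifts to one killed by `C`, hence is zero after `d` is
    -- cancelled; so `reduced` inherits the trivial kernel.
    pivot t₀ d≉0 = wide-kernel m reduced λ z′ reduced-z′≈0 s →
        cancel-nonzero d≉0 (triv (lift z′) (kernel z′ reduced-z′≈0) (suc s))
      where
      d = C t₀ zero

      -- Elimination by cross multiplication, so that no inverse of the pivot enters.
      reduced : Fin m → Fin (suc m) → Carrier
      reduced t s = d ⊛ C (punchIn t₀ t) (suc s) ⊕ - C (punchIn t₀ t) zero ⊛ C t₀ (suc s)

      module _ (z′ : Fin (suc m) → Carrier) where
        S : Fin (suc m) → Carrier
        S t = sum (λ s → C t (suc s) ⊛ z′ s)

        -- The first coordinate is the one that row `t₀` forces once the others are scaled by `d`.
        lift : Fin (suc (suc m)) → Carrier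
        lift = (- S t₀) ◂ λ s → d ⊛ z′ s

        row : ∀ t → sum (λ s → C t s ⊛ lift s) ≈ d ⊛ S t ⊕ - C t zero ⊛ S t₀
        row t = begin
          C t zero ⊛ - S t₀ ⊕ sum (λ s → C t (suc s) ⊛ (d ⊛ z′ s))
            ≈⟨ +-congˡ (sum-cong-≋ {x = λ s → C t (suc s) ⊛ (d ⊛ z′ s)}
                                     {y = λ s → d ⊛ (C t (suc s) ⊛ z′ s)} λ s →
                 solve 3 (λ a d z → a :* (d :* z) := d :* (a :* z)) ≈-refl (C t (suc s)) d (z′ s)) ⟩
          C t zero ⊛ - S t₀ ⊕ sum (λ s → d ⊛ (C t (suc s) ⊛ z′ s))
            ≈⟨ +-cong (trans (sym (-‿distribʳ-* _ _)) (-‿distribˡ-* _ _))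
                      (sym (*-distribˡ-sum d (λ s → C t (suc s) ⊛ z′ s))) ⟩
          - C t zero ⊛ S t₀ ⊕ d ⊛ S t
            ≈⟨ +-comm _ _ ⟩
          d ⊛ S t ⊕ - C t zero ⊛ S t₀ ∎

        kernel : (∀ t → sum (λ s → reduced t s ⊛ z′ s) ≈ 0#) → ∀ t → sum (λ s → C t s ⊛ lift s) ≈ 0#
        kernel reduced-z′≈0 t with t₀ ≟ t
        ... | yes refl = trans (row t) (trans (+-congˡ (sym (-‿distribˡ-* _ _))) (-‿inverseʳ _))
        ... | no t₀≢t  = subst (λ t → sum (λ s → C t s ⊛ lift s) ≈ 0#) (punchIn-punchOut t₀≢t)
          (other-rows (punchOut t₀≢t))
          where
          other-rows : ∀ t′ → sum (λ s → C (punchIn t₀ t′) s ⊛ lift s) ≈ 0#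
          other-rows t′ = trans (row u) (trans
            (sym (sum-linear d (- C u zero) (λ s → C u (suc s)) (λ s → C t₀ (suc s)) z′))
            (reduced-z′≈0 t′))
            where u = punchIn t₀ t′

  -- Uniqueness of the rank

  indep-tail : ∀ {n r} (A : Matrix F n) (col : Fin (suc r) → Fin n) →
    LinIndepCols F A col → LinIndepCols F A (col ∘ suc)
  indep-tail A col indep x eq t =
    indep (0# ◂ x) (λ row → trans (+-cong (zeroʳ _) (eq row)) (+-identityˡ 0#)) (suc t)

  -- `HasRank` only excludes families one larger than the rank; dropping leading columns brings a
  -- larger family down to that size.
  no-more-indep : ∀ {n r} (A : Matrix F n) →
    (∀ (col : Fin r → Fin n) → Injective _≡_ _≡_ col → ¬ LinIndepCols F A col) →
    ∀ d (col : Fin (d + r) → Fin n) → Injective _≡_ _≡_ col → ¬ LinIndepCols F A col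
  no-more-indep A max zero    col inj indep = max col inj indep
  no-more-indep A max (suc d) col inj indep =
    no-more-indep A max d (col ∘ suc) (suc-injective ∘ inj) (indep-tail A col indep)

  rank-≤ : ∀ {n r s} (A : Matrix F n) → HasRank F A r → HasRank F A s → r ≤ s
  rank-≤ {r = r} {s} A ((col , inj , indep) , _) (_ , max) = ℕ.≮⇒≥ λ s<r →
    let d , eq = ℕ.m≤n⇒∃[o]m+o≡n s<r
        r≡     = ≡.trans (≡.sym eq) (ℕ.+-comm (suc s) d)
    in case subst (λ m → Σ (Fin m → _) λ col → Injective _≡_ _≡_ col × LinIndepCols F A col)
                  r≡ (col , inj , indep)
       of λ { (col′ , inj′ , indep′) → no-more-indep A max d col′ inj′ indep′ }

-- Perfect matchings and even cycles

unique-resp-↭ : ∀ {a} {A : Set a} {xs ys : List A} → xs ↭ ys → Unique xs → Unique ys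
unique-resp-↭ p = Permₛ.Unique-resp-↭ (≡.setoid _) (↭⇒↭ₛ p)

head∉tail : ∀ {a} {A : Set a} {x : A} {xs} → Unique (x ∷ xs) → x ∉ xs
head∉tail (x≢xs ∷ _) x∈xs = All.lookup x≢xs x∈xs refl

-- Sorts the collisions of an alternating walk into odd gaps, which are impossible, and positive
-- even gaps, which unwind to a return to the start.
parity-of-gap : ∀ {i j} → i < j → ∃ λ d → (j ≡ suc (d * 2 + i)) ⊎ (j ≡ suc d * 2 + i)
parity-of-gap {zero}  {suc zero}          _         = 0 , inj₁ refl
parity-of-gap {zero}  {suc (suc zero)}    _         = 0 , inj₂ refl
parity-of-gap {zero}  {suc (suc (suc j))} _ with parity-of-gap {zero} {suc j} (s≤s z≤n)
... | d , inj₁ eq = suc d , inj₁ (cong (2 +_) eq)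
... | d , inj₂ eq = suc d , inj₂ (cong (2 +_) eq)
parity-of-gap {suc i} {suc j} (s≤s i<j) with parity-of-gap i<j
... | d , inj₁ refl = d , inj₁ (cong suc (≡.sym (ℕ.+-suc (d * 2) i)))
... | d , inj₂ refl = d , inj₂ (cong (2 +_) (≡.sym (ℕ.+-suc (d * 2) i)))

greatest : ∀ b {P : ℕ → Set} → (∀ k → Dec (P k)) → P 0 → ∃ λ k → P k × (∀ m → P m → m ≤ b → m ≤ k)
greatest zero    P? P0 = 0 , P0 , λ _ _ m≤0 → m≤0
greatest (suc b) P? P0 with P? (suc b)
... | yes Pb = suc b , Pb , λ _ _ m≤b → m≤b
... | no ¬Pb = let k , Pk , max = greatest b P? P0 in
  k , Pk , λ m Pm m≤1+b → max m Pm (ℕ.≤-pred (ℕ.≤∧≢⇒< m≤1+b λ { refl → ¬Pb Pm }))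

module Matchings (G : Graph) where
  open Graph G using (n; adj; irrefl)

  V : Set
  V = Fin n

  infix 4 _─_
  _─_ : V → V → Set
  _─_ = Edge G

  no-loop : ∀ {x} → ¬ (x ─ x)
  no-loop {x} e with () ← ≡.trans (≡.sym e) (irrefl x)

  edge-sym : ∀ {x y} → x ─ y → y ─ x
  edge-sym {x} {y} e = ≡.trans (Graph.sym G y x) e

  -- A perfect matching of a list, built edge by edge. The permutation lets the two ends of an edge
  -- stand anywhere in the list; distinctness of the entries comes separately, from `Unique`.
  data Matched : ℕ → List V → Set where
    nil  : Matched 0 []
    pair : ∀ {h x z R L} → x ─ z → Matched h R → L ↭ x ∷ z ∷ R → Matched (suc h) L

  matched-length : ∀ {h L} → Matched h L → length L ≡ 2 * h
  matched-length nil                = refl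
  matched-length (pair {h} _ m L↭) =
    ≡.trans (↭-length L↭) (≡.trans (cong (2 +_) (matched-length m)) (≡.sym (ℕ.*-suc 2 h)))

  -- A perfect matching as an involution, extended by the identity outside `L` so that it is
  -- injective on all vertices.
  record Mate (L : List V) : Set where
    field
      mate       : V → V
      involutive : ∀ v → mate (mate v) ≡ v
      edge       : ∀ {v} → v ∈ L → v ─ mate v
      fixed      : ∀ {v} → v ∉ L → mate v ≡ v

    mate-injective : ∀ {u v} → mate u ≡ mate v → u ≡ v
    mate-injective {u} {v} eq = ≡.trans (≡.sym (involutive u)) (≡.trans (cong mate eq) (involutive v))

    -- A mate outside `L` would be fixed, hence equal to `v`, and the edge to it would be a loop.
    closed : ∀ {v} → v ∈ L → mate v ∈ L
    closed {v} v∈L with mem? _≟_ (mate v) L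
    ... | yes mv∈L = mv∈L
    ... | no  mv∉L = contradiction (subst (v ─_) (≡.sym v≡mv) (edge v∈L)) no-loop
      where v≡mv = ≡.trans (≡.sym (involutive v)) (fixed mv∉L)

  open Mate

  mate-resp-↭ : ∀ {L L′} → L ↭ L′ → Mate L → Mate L′
  mate-resp-↭ p M = record
    { mate       = mate M
    ; involutive = involutive M
    ; edge       = edge M ∘ ∈-resp-↭ (↭-sym p)
    ; fixed      = λ v∉ → fixed M (v∉ ∘ ∈-resp-↭ p)
    }

  add-pair : ∀ {x z R} → x ─ z → Unique (x ∷ z ∷ R) → Mate R →
    Σ (Mate (x ∷ z ∷ R)) λ M → mate M x ≡ z
  add-pair {x} {z} {R} e u@(_ ∷ u′) M = record
      { mate = swapped ; involutive = invol ; edge = swapped-edge ; fixed = swapped-fixed } , at-x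
    where
    x∉R : x ∉ R
    x∉R = head∉tail u ∘ there

    z∉R : z ∉ R
    z∉R = head∉tail u′

    x≢z : x ≢ z
    x≢z refl = no-loop e

    swapped : V → V
    swapped v with v ≟ x | v ≟ z
    ... | yes _ | _     = z
    ... | no _  | yes _ = x
    ... | no _  | no _  = mate M v

    at-x : swapped x ≡ z
    at-x with x ≟ x | x ≟ z
    ... | yes _  | _ = refl
    ... | no x≢x | _ = contradiction refl x≢x

    at-z : swapped z ≡ x
    at-z with z ≟ x | z ≟ z
    ... | yes z≡x | _      = contradiction (≡.sym z≡x) x≢z
    ... | no _    | yes _  = refl
    ... | no _    | no z≢z = contradiction refl z≢z

    elsewhere : ∀ {v} → v ≢ x → v ≢ z → swapped v ≡ mate M v
    elsewhere {v} v≢x v≢z with v ≟ x | v ≟ z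
    ... | yes v≡x | _       = contradiction v≡x v≢x
    ... | no _    | yes v≡z = contradiction v≡z v≢z
    ... | no _    | no _    = refl

    -- A vertex outside `R` is fixed by the involution, so its only preimage is itself.
    off-target : ∀ {v y} → y ∉ R → v ≢ y → mate M v ≢ y
    off-target y∉R v≢y refl = v≢y (≡.trans (≡.sym (involutive M _)) (fixed M y∉R))

    invol : ∀ v → swapped (swapped v) ≡ v
    invol v with v ≟ x | v ≟ z
    ... | yes refl | _        = at-z
    ... | no _     | yes refl = at-x
    ... | no v≢x   | no v≢z   =
      ≡.trans (elsewhere (off-target x∉R v≢x) (off-target z∉R v≢z)) (involutive M v)

    swapped-edge : ∀ {v} → v ∈ x ∷ z ∷ R → v ─ swapped v
    swapped-edge (here refl)         = subst (x ─_) (≡.sym at-x) e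
    swapped-edge (there (here refl)) = subst (z ─_) (≡.sym at-z) (edge-sym e)
    swapped-edge (there (there v∈R)) =
      subst (_ ─_) (≡.sym (elsewhere (λ { refl → x∉R v∈R }) (λ { refl → z∉R v∈R }))) (edge M v∈R)

    swapped-fixed : ∀ {v} → v ∉ x ∷ z ∷ R → swapped v ≡ v
    swapped-fixed v∉ =
      ≡.trans (elsewhere (v∉ ∘ here) (v∉ ∘ there ∘ here)) (fixed M (v∉ ∘ there ∘ there))

  matched⇒mate : ∀ {h L} → Matched h L → Unique L → Mate L
  -- The mate of `x` is recorded because two matchings are later compared there.
  pair⇒mate : ∀ {h x z R L} → x ─ z → Matched h R → L ↭ x ∷ z ∷ R → Unique L →
    Σ (Mate L) λ M → mate M x ≡ z

  matched⇒mate nil _ = record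
    { mate = λ v → v ; involutive = λ _ → refl ; edge = λ () ; fixed = λ _ → refl }
  matched⇒mate (pair e m p) u = proj₁ (pair⇒mate e m p u)

  pair⇒mate e m p u with unique-resp-↭ p u
  ... | u′@(_ ∷ _ ∷ uR) with add-pair e u′ (matched⇒mate m uR)
  ...   | M , Mx≡z = mate-resp-↭ (↭-sym p) M , Mx≡z

  -- The walk from x that alternately follows M and N closes up into an even cycle.
  module Alternating {L} (M N : Mate L) {x} (x∈L : x ∈ L) (Mx≢Nx : mate M x ≢ mate N x) where

    turn : ℕ → Mate L
    turn zero          = M
    turn (suc zero)    = N
    turn (suc (suc i)) = turn i

    turn-periodic : ∀ d i → turn (d * 2 + i) ≡ turn i
    turn-periodic zero    i = refl
    turn-periodic (suc d) i = turn-periodic d i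

    walk : ℕ → V
    walk zero    = x
    walk (suc i) = mate (turn i) (walk i)

    walk∈L : ∀ i → walk i ∈ L
    walk∈L zero    = x∈L
    walk∈L (suc i) = closed (turn i) (walk∈L i)

    walk-edge : ∀ i → walk i ─ walk (suc i)
    walk-edge i = edge (turn i) (walk∈L i)

    -- An even gap keeps both positions in phase: they are reached by the same involution, and its
    -- injectivity allows a step back.
    unwind : ∀ d i → walk i ≡ walk (d * 2 + i) → walk 0 ≡ walk (d * 2)
    unwind d zero    eq = ≡.trans eq (cong walk (ℕ.+-identityʳ (d * 2)))
    unwind d (suc i) eq = unwind d i (mate-injective (turn i) (begin
      walk (suc i)                               ≡⟨ eq ⟩
      walk (d * 2 + suc i)                       ≡⟨ cong walk (ℕ.+-suc (d * 2) i) ⟩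
      mate (turn (d * 2 + i)) (walk (d * 2 + i)) ≡⟨ cong (λ T → mate T (walk (d * 2 + i)))
                                                       (turn-periodic d i) ⟩
      mate (turn i) (walk (d * 2 + i))           ∎))
      where open ≡-Reasoning

    -- With an odd gap, the step out of the earlier position and the step into the later one use the
    -- same involution. The gap therefore shrinks from both ends, until an edge would be a loop.
    odd-gap : ∀ d i → walk i ≢ walk (suc (d * 2 + i))
    odd-gap zero    i eq = no-loop (subst (walk i ─_) (≡.sym eq) (walk-edge i))
    odd-gap (suc d) i eq = odd-gap d (suc i) (begin
      mate (turn i) (walk i)                           ≡⟨ cong (mate (turn i)) eq ⟩
      mate (turn i) (mate (turn (d * 2 + i)) (walk k)) ≡⟨ cong (λ T → mate (turn i) (mate T (walk k)))
                                                             (turn-periodic d i) ⟩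
      mate (turn i) (mate (turn i) (walk k))           ≡⟨ involutive (turn i) _ ⟩
      walk k                                           ≡⟨ cong (λ k → walk (suc k)) (ℕ.+-suc (d * 2) i) ⟨
      walk (suc (d * 2 + suc i))                       ∎)
      where
      open ≡-Reasoning
      k = suc (suc (d * 2 + i))

    Returns : ℕ → Set
    Returns p = walk 0 ≡ walk (suc p * 2)

    -- Among `n + 1` even times two share a vertex; unwinding them gives a return to the start.
    returns : ∃ Returns
    returns with pigeonhole (ℕ.n<1+n n) (λ a → walk (toℕ a * 2))
    ... | a , b , a<b , eq with ℕ.m≤n⇒∃[o]m+o≡n a<b
    ...   | d , 1+a+d≡b = d , unwind (suc d) (toℕ a * 2) (≡.trans eq (cong walk (begin
        toℕ b * 2             ≡⟨ cong (_* 2) 1+a+d≡b ⟨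
        (suc (toℕ a) + d) * 2 ≡⟨ cong (λ m → suc m * 2) (ℕ.+-comm (toℕ a) d) ⟩
        (suc d + toℕ a) * 2   ≡⟨ ℕ.*-distribʳ-+ 2 (suc d) (toℕ a) ⟩
        suc d * 2 + toℕ a * 2 ∎)))
      where open ≡-Reasoning

    first-return : ∃ λ p → Returns p × (∀ {q} → q < p → ¬ Returns q)
    first-return with returns
    ... | d , ret with Fin.¬∀⟶∃¬-smallest (suc d) (λ i → walk 0 ≢ walk (suc (toℕ i) * 2))
                         (λ i → ¬? (walk 0 ≟ walk (suc (toℕ i) * 2)))
                         (λ never → never (fromℕ d) (subst Returns (≡.sym (toℕ-fromℕ d)) ret))
    ...   | i , ¬¬ret , before = toℕ i , decidable-stable (_ ≟ _) ¬¬ret , λ {q} q<i ret-q →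
      before (fromℕ< q<i) (subst Returns (≡.sym (≡.trans (Fin.toℕ-inject (fromℕ< q<i)) (toℕ-fromℕ< q<i))) ret-q)

    even-cycle : ¬ NoEvenCycle G
    even-cycle none with first-return
    -- A return after two steps would make `M` and `N` agree at `x`, so the first return takes at
    -- least four.
    ... | zero  , ret , _ = Mx≢Nx (≡.trans (≡.sym (involutive N _)) (cong (mate N) (≡.sym ret)))
    -- The cycle visits the times below `suc (suc p) * 2`, which computes to `3 + suc (p * 2)`.
    ... | suc p , ret , first = none (suc (p * 2)) (walk ∘ toℕ) (injective , edges , closing)
                                  (divides (suc (suc p)) refl)
      where
      -- An even gap this short would unwind to a return before the first one.
      distinct : ∀ {i j} → i < j → j < suc (suc p) * 2 → walk i ≢ walk j
      distinct {i} i<j j<2p eq with parity-of-gap i<j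
      ... | d , inj₁ refl = odd-gap d i eq
      ... | d , inj₂ refl = first {d}
                              (ℕ.≤-pred (ℕ.*-cancelʳ-< 2 _ _ (ℕ.≤-<-trans (ℕ.m≤m+n (suc d * 2) i) j<2p)))
                              (unwind (suc d) i eq)

      injective : Injective _≡_ _≡_ (walk ∘ toℕ)
      injective {i} {j} eq with ℕ.<-cmp (toℕ i) (toℕ j)
      ... | tri< i<j _ _ = contradiction eq (distinct i<j (toℕ<n j))
      ... | tri≈ _ i≡j _ = toℕ-injective i≡j
      ... | tri> _ _ j<i = contradiction (≡.sym eq) (distinct j<i (toℕ<n i))

      edges : ∀ i → walk (toℕ (inject₁ i)) ─ walk (suc (toℕ i))
      edges i = subst (λ k → walk k ─ walk (suc (toℕ i))) (≡.sym (toℕ-inject₁ i)) (walk-edge (toℕ i))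

      closing : walk (toℕ (fromℕ (3 + p * 2))) ─ walk 0
      closing = subst₂ (λ k v → walk k ─ v) (≡.sym (toℕ-fromℕ (3 + p * 2))) (≡.sym ret)
                  (walk-edge (3 + p * 2))

  -- Perfect matchings of lists versus matchings of the graph

  ⊎-injective : ∀ {k} {p q : Fin k → V} → Injective _≡_ _≡_ p → Injective _≡_ _≡_ q →
    (∀ i j → p i ≢ q j) → Injective _≡_ _≡_ [ p , q ]
  ⊎-injective p-inj q-inj p≢q {inj₁ i} {inj₁ j} eq = cong inj₁ (p-inj eq)
  ⊎-injective p-inj q-inj p≢q {inj₁ i} {inj₂ j} eq = contradiction eq (p≢q i j)
  ⊎-injective p-inj q-inj p≢q {inj₂ i} {inj₁ j} eq = contradiction (≡.sym eq) (p≢q j i)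
  ⊎-injective p-inj q-inj p≢q {inj₂ i} {inj₂ j} eq = cong inj₂ (q-inj eq)

  ◂-injective : ∀ {k} {x : V} {p : Fin k → V} → (∀ i → x ≢ p i) → Injective _≡_ _≡_ p →
    Injective _≡_ _≡_ (x ◂ p)
  ◂-injective x≢p p-inj {zero}  {zero}  eq = refl
  ◂-injective x≢p p-inj {zero}  {suc j} eq = contradiction eq (x≢p j)
  ◂-injective x≢p p-inj {suc i} {zero}  eq = contradiction (≡.sym eq) (x≢p i)
  ◂-injective x≢p p-inj {suc i} {suc j} eq = cong suc (p-inj eq)

  matched⇒matching : ∀ {h L} → Matched h L → Unique L → HasMatching G h
  matched⇒matching M U = let p , q , edges , inj , _ = go M U in p , q , edges , inj
    where
    -- The induction also records that all ends lie in `L`, so that a new edge avoids the old ones.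
    go : ∀ {h L} → Matched h L → Unique L → Σ (Fin h → V) λ p → Σ (Fin h → V) λ q →
      (∀ t → p t ─ q t) × Injective _≡_ _≡_ [ p , q ] × (∀ s → [ p , q ] s ∈ L)
    go nil _ = (λ ()) , (λ ()) , (λ ()) , (λ { {inj₁ ()} ; {inj₂ ()} }) , λ { (inj₁ ()) ; (inj₂ ()) }
    go {suc h} {L} (pair {x = x} {z} e M L↭) U with unique-resp-↭ L↭ U
    ... | u@(_ ∷ u′@(_ ∷ u″)) with go M u″
    ...   | p , q , edges , inj , range =
        x ◂ p , z ◂ q , (λ { zero → e ; (suc t) → edges t })
      , ⊎-injective (◂-injective (x≢ ∘ inj₁) (λ eq → Sum.inj₁-injective (inj eq)))
                    (◂-injective (z≢ ∘ inj₂) (λ eq → Sum.inj₂-injective (inj eq)))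
                    (λ { zero    zero    refl → no-loop e
                       ; zero    (suc j) eq   → x≢ (inj₂ j) eq
                       ; (suc i) zero    eq   → z≢ (inj₁ i) (≡.sym eq)
                       ; (suc i) (suc j) eq   → contradiction (inj {inj₁ i} {inj₂ j} eq) λ () })
      , λ { (inj₁ zero)    → back (here refl)
          ; (inj₁ (suc i)) → back (there (there (range (inj₁ i))))
          ; (inj₂ zero)    → back (there (here refl))
          ; (inj₂ (suc i)) → back (there (there (range (inj₂ i)))) }
      where
      back : ∀ {v} → v ∈ x ∷ z ∷ _ → v ∈ L
      back = ∈-resp-↭ (↭-sym L↭)

      x≢ : ∀ s → x ≢ [ p , q ] s
      x≢ s refl = head∉tail u (there (range s))

      z≢ : ∀ s → z ≢ [ p , q ] s
      z≢ s refl = head∉tail u′ (range s)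

  matching⇒matched : ∀ {h} → HasMatching G h → ∃ λ L → Matched h L × Unique L
  matching⇒matched (p , q , edges , inj) = let L , M , U , _ = go p q edges inj in L , M , U
    where
    go : ∀ {h} (p q : Fin h → V) → (∀ t → p t ─ q t) → Injective _≡_ _≡_ [ p , q ] →
      ∃ λ L → Matched h L × Unique L × (∀ {v} → v ∈ L → ∃ λ s → v ≡ [ p , q ] s)
    go {zero}  p q edges inj = [] , nil , [] , λ ()
    go {suc h} p q edges inj with go (p ∘ suc) (q ∘ suc) (edges ∘ suc) tail-inj
      where
      tail-inj : Injective _≡_ _≡_ [ p ∘ suc , q ∘ suc ]
      tail-inj = ⊎-injective (λ eq → suc-injective (Sum.inj₁-injective (inj eq)))
                             (λ eq → suc-injective (Sum.inj₂-injective (inj eq)))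
                             (λ i j eq → contradiction (inj {inj₁ (suc i)} {inj₂ (suc j)} eq) λ ())
    ... | L , M , U , source = p zero ∷ q zero ∷ L , pair (edges zero) M ↭-refl
      , ((p₀≢q₀ ∷ fresh (inj₁ zero) (λ _ ()) (λ _ ())) ∷ fresh (inj₂ zero) (λ _ ()) (λ _ ()) ∷ U)
      , λ { (here refl)         → inj₁ zero , refl
          ; (there (here refl)) → inj₂ zero , refl
          ; (there (there v∈L)) → later (source v∈L) }
      where
      p₀≢q₀ : p zero ≢ q zero
      p₀≢q₀ eq = contradiction (inj {inj₁ zero} {inj₂ zero} eq) λ ()

      later : ∀ {v} → (∃ λ s → v ≡ [ p ∘ suc , q ∘ suc ] s) → ∃ λ s → v ≡ [ p , q ] s
      later (inj₁ i , eq) = inj₁ (suc i) , eq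
      later (inj₂ i , eq) = inj₂ (suc i) , eq

      fresh : ∀ s → (∀ i → s ≢ inj₁ (suc i)) → (∀ i → s ≢ inj₂ (suc i)) → All ([ p , q ] s ≢_) L
      fresh s s≢₁ s≢₂ = All.tabulate λ v∈L eq → case source v∈L of λ
        { (inj₁ i , eq′) → s≢₁ i (inj (≡.trans eq eq′))
        ; (inj₂ i , eq′) → s≢₂ i (inj (≡.trans eq eq′)) }

  -- Existence of the matching number

  any-function? : ∀ k {P : (Fin k → V) → Set} → (∀ {f g} → (∀ i → f i ≡ g i) → P f → P g) →
    (∀ f → Dec (P f)) → Dec (∃ P)
  any-function? zero    ext P? = map′ (λ Pf → _ , Pf) (λ (_ , Pf) → ext (λ ()) Pf) (P? λ ())
  any-function? (suc k) ext P? = map′ (λ (x , f , Pxf) → x ◂ f , Pxf)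
    -- `f` and `f zero ◂ f ∘ suc` are only known to agree pointwise, which is why `P` must respect
    -- pointwise equality.
    (λ (f , Pf) → f zero , f ∘ suc , ext (λ { zero → refl ; (suc i) → refl }) Pf)
    (Fin.any? λ x → any-function? k (λ f≗g → ext λ { zero → refl ; (suc i) → f≗g i }) (λ f → P? (x ◂ f)))

  disjoint? : ∀ {k} (p q : Fin k → V) → Dec (Injective _≡_ _≡_ [ p , q ])
  disjoint? p q = map′
    (λ (pp , qq , pq) → ⊎-injective (λ {i} {j} → pp i j) (λ {i} {j} → qq i j) pq)
    (λ inj → (λ i j eq → Sum.inj₁-injective (inj eq)) , (λ i j eq → Sum.inj₂-injective (inj eq)) ,
             (λ i j eq → contradiction (inj {inj₁ i} {inj₂ j} eq) λ ()))
    (Fin.all? (λ i → Fin.all? λ j → (p i ≟ p j) →-dec (i ≟ j)) ×-dec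
     Fin.all? (λ i → Fin.all? λ j → (q i ≟ q j) →-dec (i ≟ j)) ×-dec
     Fin.all? (λ i → Fin.all? λ j → ¬? (p i ≟ q j)))

  matching? : ∀ k → Dec (HasMatching G k)
  matching? k = any-function? k (λ p≗ (q , m) → q , resp p≗ (λ _ → refl) m) λ p →
    any-function? k (resp (λ _ → refl)) λ q →
      Fin.all? (λ t → adj (p t) (q t) Bool.≟ true) ×-dec disjoint? p q
    where
    resp : ∀ {p p′ q q′ : Fin k → V} → (∀ i → p i ≡ p′ i) → (∀ i → q i ≡ q′ i) →
      (∀ t → p t ─ q t) × Injective _≡_ _≡_ [ p , q ] →
      (∀ t → p′ t ─ q′ t) × Injective _≡_ _≡_ [ p′ , q′ ]
    resp {p} {p′} {q} {q′} p≗ q≗ (edges , inj) =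
      (λ t → subst₂ _─_ (p≗ t) (q≗ t) (edges t)) ,
      λ {s} {t} eq → inj (≡.trans (both s) (≡.trans eq (≡.sym (both t))))
      where
      both : ∀ s → [ p , q ] s ≡ [ p′ , q′ ] s
      both (inj₁ i) = p≗ i
      both (inj₂ i) = q≗ i

  -- The first ends of the edges are distinct vertices, so a search up to `n` finds the maximum.
  matching-number : ∃ (IsMatchingNumber G)
  matching-number = let k , m , max = greatest n matching? no-edges in
      k , m , λ j m′ → max j m′ (Fin.injective⇒≤ (λ eq → Sum.inj₁-injective (proj₂ (proj₂ (proj₂ m′)) eq)))
    where
    no-edges : HasMatching G 0
    no-edges = matched⇒matching nil []

-- Pfaffians

lookup-injective : ∀ {a} {A : Set a} {xs : List A} → Unique xs → Injective _≡_ _≡_ (lookup xs)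
lookup-injective (_ ∷ u)  {zero}  {zero}  eq = refl
lookup-injective (x≢ ∷ u) {zero}  {suc j} eq = contradiction eq (All.lookup x≢ (∈-lookup j))
lookup-injective (x≢ ∷ u) {suc i} {zero}  eq = contradiction (≡.sym eq) (All.lookup x≢ (∈-lookup i))
lookup-injective (_ ∷ u)  {suc i} {suc j} eq = cong suc (lookup-injective u eq)

module Pfaffian {c ℓ} (F : Field c ℓ) (char≢2 : CharNot2 F) {n} (A : Matrix F n)
  (skew : ∀ i j → Field._≈_ F (A i j) (Field.-_ F (A j i))) where

  open Field F hiding (zero; _+_; _*_; refl)
  open Field F using () renaming (_+_ to infixl 6 _⊕_; _*_ to infixl 7 _⊛_; refl to ≈-refl)
  open RawMonoidDefs +-rawMonoid using (sum)
  open SemiringSum semiring using (sum-cong-≋; *-distribˡ-sum)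
  open RingProperties ring using (-0#≈0#; -‿involutive; -‿distribˡ-*; -‿distribʳ-*; -‿+-comm; -1*x≈-x; x∙y⁻¹≈ε⇒x≈y)
  open SetoidReasoning setoid
  open SemiringSolver commutativeSemiring using (solve; _:=_; _:+_; _:*_)
  open LinearAlgebra F

  V : Set
  V = Fin n

  Form : Set c
  Form = List V → Carrier

  -- Here characteristic two is excluded; this gives the zero diagonal and the vanishing of
  -- alternating forms at repeated indices.
  self-neg : ∀ {a} → a ≈ - a → a ≈ 0#
  self-neg {a} a≈-a = cancel-nonzero char≢2 (begin
    (1# ⊕ 1#) ⊛ a ≈⟨ distribʳ a 1# 1# ⟩
    1# ⊛ a ⊕ 1# ⊛ a ≈⟨ +-cong (*-identityˡ a) (trans (*-identityˡ a) a≈-a) ⟩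
    a ⊕ - a       ≈⟨ -‿inverseʳ a ⟩
    0#            ∎)

  diagonal : ∀ i → A i i ≈ 0#
  diagonal i = self-neg (skew i i)

  neg-sub : ∀ a b → - (a ⊕ - b) ≈ - a ⊕ b
  neg-sub a b = trans (sym (-‿+-comm a (- b))) (+-congˡ (-‿involutive b))

  sub-neg : ∀ {u u′ d d′} → u ≈ - u′ → d ≈ - d′ → u ⊕ - d ≈ - (u′ ⊕ - d′)
  sub-neg {u} {u′} {d} {d′} u≈ d≈ = trans (+-cong u≈ (-‿cong d≈)) (-‿+-comm u′ (- d′))

  -- The sign pattern shared by exchanging two contractions and by exchanging the first two entries
  -- of a contracted list.
  sub-sub-neg : ∀ p q {x y} → x ≈ - y → p ⊕ - (q ⊕ - x) ≈ - (q ⊕ - (p ⊕ - y))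
  sub-sub-neg p q {x} {y} x≈-y = begin
    p ⊕ - (q ⊕ - x)   ≈⟨ +-congˡ (neg-sub q x) ⟩
    p ⊕ (- q ⊕ x)     ≈⟨ solve 3 (λ p q x → p :+ (q :+ x) := q :+ (p :+ x)) ≈-refl p (- q) x ⟩
    - q ⊕ (p ⊕ x)     ≈⟨ +-congˡ (+-congˡ x≈-y) ⟩
    - q ⊕ (p ⊕ - y)   ≈⟨ neg-sub q (p ⊕ - y) ⟨
    - (q ⊕ - (p ⊕ - y)) ∎

  -- Contraction with row x of A: the signed sum of A x w times φ of the list with w deleted.
  ∂ : V → Form → Form
  ∂ x φ []      = 0#
  ∂ x φ (y ∷ L) = A x y ⊛ φ L ⊕ - ∂ x (φ ∘ (y ∷_)) L

  -- The Pfaffian of the principal submatrix indexed by a list of length 2h (junk value 0 at other lengths).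
  Pf : ℕ → Form
  Pf zero    []      = 1#
  Pf zero    (_ ∷ _) = 0#
  Pf (suc h) []      = 0#
  Pf (suc h) (x ∷ L) = ∂ x (Pf h) L

  ∂-cong : ∀ x {φ ψ} L → (∀ L → φ L ≈ ψ L) → ∂ x φ L ≈ ∂ x ψ L
  ∂-cong x []      φ≈ψ = ≈-refl
  ∂-cong x (y ∷ L) φ≈ψ = +-cong (*-congˡ (φ≈ψ L)) (-‿cong (∂-cong x L (φ≈ψ ∘ (y ∷_))))

  ∂-neg : ∀ x {φ ψ} L → (∀ L → φ L ≈ - ψ L) → ∂ x φ L ≈ - ∂ x ψ L
  ∂-neg x []      φ≈-ψ = sym -0#≈0#
  ∂-neg x (y ∷ L) φ≈-ψ = sub-neg (trans (*-congˡ (φ≈-ψ L)) (sym (-‿distribʳ-* _ _)))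
                                 (∂-neg x L (φ≈-ψ ∘ (y ∷_)))

  ∂-linear : ∀ x a φ ψ L → ∂ x (λ L → a ⊛ φ L ⊕ - ψ L) L ≈ a ⊛ ∂ x φ L ⊕ - ∂ x ψ L
  ∂-linear x a φ ψ []      = sym (trans (+-cong (zeroʳ a) -0#≈0#) (+-identityˡ 0#))
  ∂-linear x a φ ψ (y ∷ L) = begin
    A x y ⊛ (a ⊛ p ⊕ - q) ⊕ - ∂ x (λ L → a ⊛ φ (y ∷ L) ⊕ - ψ (y ∷ L)) L
      ≈⟨ +-congˡ (-‿cong (∂-linear x a (φ ∘ (y ∷_)) (ψ ∘ (y ∷_)) L)) ⟩
    A x y ⊛ (a ⊛ p ⊕ - q) ⊕ - (a ⊛ D ⊕ - E)
      ≈⟨ +-congˡ (trans (neg-sub (a ⊛ D) E) (+-congʳ (-‿distribʳ-* a D))) ⟩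
    A x y ⊛ (a ⊛ p ⊕ - q) ⊕ (a ⊛ - D ⊕ E)
      ≈⟨ solve 6 (λ b a p q D E → b :* (a :* p :+ q) :+ (a :* D :+ E)
                               := a :* (b :* p :+ D) :+ (b :* q :+ E)) ≈-refl (A x y) a p (- q) (- D) E ⟩
    a ⊛ (A x y ⊛ p ⊕ - D) ⊕ (A x y ⊛ - q ⊕ E)
      ≈⟨ +-congˡ (trans (neg-sub (A x y ⊛ q) E) (+-congʳ (-‿distribʳ-* (A x y) q))) ⟨
    a ⊛ (A x y ⊛ p ⊕ - D) ⊕ - (A x y ⊛ q ⊕ - E) ∎
    where
    p = φ L
    q = ψ L
    D = ∂ x (φ ∘ (y ∷_)) L
    E = ∂ x (ψ ∘ (y ∷_)) L

  -- As for contractions in an exterior algebra: expanding at `z`, the terms with one contraction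
  -- match crosswise, and those with two are handled by induction.
  ∂-anticomm : ∀ x y φ L → ∂ x (∂ y φ) L ≈ - ∂ y (∂ x φ) L
  ∂-anticomm x y φ []      = sym -0#≈0#
  ∂-anticomm x y φ (z ∷ L) = begin
    A x z ⊛ ∂ y φ L ⊕ - ∂ x (λ L → A y z ⊛ φ L ⊕ - ∂ y φz L) L
      ≈⟨ +-congˡ (-‿cong (∂-linear x (A y z) φ (∂ y φz) L)) ⟩
    A x z ⊛ ∂ y φ L ⊕ - (A y z ⊛ ∂ x φ L ⊕ - ∂ x (∂ y φz) L)
      ≈⟨ sub-sub-neg _ _ (∂-anticomm x y φz L) ⟩
    - (A y z ⊛ ∂ x φ L ⊕ - (A x z ⊛ ∂ y φ L ⊕ - ∂ y (∂ x φz) L))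
      ≈⟨ -‿cong (+-congˡ (-‿cong (∂-linear y (A x z) φ (∂ x φz) L))) ⟨
    - (A y z ⊛ ∂ x φ L ⊕ - ∂ y (λ L → A x z ⊛ φ L ⊕ - ∂ x φz L) L) ∎
    where
    φz : Form
    φz = φ ∘ (z ∷_)

  ∂-vanish : ∀ x φ L → (∀ P w Q → L ≡ P ++ w ∷ Q → A x w ⊛ φ (P ++ Q) ≈ 0#) → ∂ x φ L ≈ 0#
  ∂-vanish x φ []      terms = ≈-refl
  ∂-vanish x φ (y ∷ L) terms = trans (+-cong (terms [] y L refl)
    (trans (-‿cong (∂-vanish x (φ ∘ (y ∷_)) L λ P w Q eq → terms (y ∷ P) w Q (cong (y ∷_) eq))) -0#≈0#))
    (+-identityˡ 0#)

  -- Alternating forms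

  Alternating : Form → Set ℓ
  Alternating φ = ∀ P x y Q → φ (P ++ x ∷ y ∷ Q) ≈ - φ (P ++ y ∷ x ∷ Q)

  ∂-alternating : ∀ x {φ} → Alternating φ → Alternating (∂ x φ)
  ∂-alternating x alt []      y z Q = sub-sub-neg _ _ (∂-neg x Q (alt [] y z))
  ∂-alternating x alt (w ∷ P) y z Q =
    sub-neg (trans (*-congˡ (alt P y z Q)) (sym (-‿distribʳ-* _ _)))
            (∂-alternating x (alt ∘ (w ∷_)) P y z Q)

  Pf-alternating : ∀ h → Alternating (Pf h)
  Pf-alternating zero    []      x y Q = sym -0#≈0#
  Pf-alternating zero    (_ ∷ _) x y Q = sym -0#≈0#
  Pf-alternating (suc h) (w ∷ P) x y Q = ∂-alternating w (Pf-alternating h) P x y Q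
  -- Exchanging the first two indices negates the leading term by skew-symmetry; the rest is a
  -- double contraction, or zero when `h` is zero.
  Pf-alternating (suc h) []      x y Q =
    sub-neg (trans (*-congʳ (skew x y)) (sym (-‿distribˡ-* _ _))) (tail h)
    where
    tail : ∀ h → ∂ x (Pf h ∘ (y ∷_)) Q ≈ - ∂ y (Pf h ∘ (x ∷_)) Q
    tail (suc h) = ∂-anticomm x y (Pf h) Q
    tail zero    = trans (vanish x) (sym (trans (-‿cong (vanish y)) -0#≈0#))
      where
      vanish : ∀ v → ∂ v (λ _ → 0#) Q ≈ 0#
      vanish v = ∂-vanish v (λ _ → 0#) Q λ _ _ _ _ → zeroʳ _

  -- Each swap only changes the sign. Claiming no more than vanishing avoids tracking the sign of a
  -- permutation.
  ↭-zero : ∀ {φ L L′} → Alternating φ → L ↭ L′ → φ L′ ≈ 0# → φ L ≈ 0#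
  ↭-zero         alt Perm.refl        φ≈0 = φ≈0
  ↭-zero {φ}     alt (prep x p)       φ≈0 = ↭-zero {φ ∘ (x ∷_)} (alt ∘ (x ∷_)) p φ≈0
  ↭-zero {φ}     alt (swap x y p)     φ≈0 = trans (alt [] x y _)
    (trans (-‿cong (↭-zero {λ L → φ (y ∷ x ∷ L)} (λ P → alt (y ∷ x ∷ P)) p φ≈0)) -0#≈0#)
  ↭-zero {φ}     alt (Perm.trans p q) φ≈0 = ↭-zero {φ} alt p (↭-zero {φ} alt q φ≈0)

  -- Once the equal entries are moved side by side, swapping them makes the value its own negative.
  repeat-zero : ∀ {φ} L → Alternating φ → ¬ Unique L → φ L ≈ 0#
  repeat-zero []      alt ¬u = contradiction [] ¬u
  repeat-zero {φ} (x ∷ L) alt ¬u with mem? _≟_ x L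
  ... | no x∉L = repeat-zero {φ ∘ (x ∷_)} L (alt ∘ (x ∷_))
                   λ u → ¬u (All.tabulate (λ { y∈L refl → x∉L y∈L }) ∷ u)
  ... | yes x∈L with ∈-∃++ x∈L
  ...   | P , Q , refl = ↭-zero {φ} alt (prep x (shift x P Q)) (self-neg (alt [] x x (P ++ Q)))

  -- Independent and spanning columns from Pfaffians

  sum-neg : ∀ {m} (f g : Fin m → Carrier) → (∀ i → f i ≈ - g i) → sum f ≈ - sum g
  sum-neg {zero}  f g f≈-g = sym -0#≈0#
  sum-neg {suc m} f g f≈-g =
    trans (+-cong (f≈-g zero) (sum-neg (f ∘ suc) (g ∘ suc) (f≈-g ∘ suc))) (-‿+-comm _ _)

  sum-single : ∀ {m} (f : Fin m → Carrier) s → (∀ t → t ≢ s → f t ≈ 0#) → sum f ≈ f s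
  sum-single f zero    f≈0 = trans (+-congˡ (sum-zero (f ∘ suc) λ t → f≈0 (suc t) λ ())) (+-identityʳ _)
  sum-single f (suc s) f≈0 = trans
    (+-cong (f≈0 zero λ ()) (sum-single (f ∘ suc) s λ t t≢s → f≈0 (suc t) (t≢s ∘ suc-injective)))
    (+-identityˡ _)

  -- The hypothesis on `h` is the recursion of `∂`; this is the induction step of `∂-kernel` and
  -- `∂-combination`.
  sum-combine : ∀ {m} a (f g h z : Fin m → Carrier) → (∀ s → h s ≈ a ⊛ f s ⊕ - g s) →
    sum (λ s → f s ⊛ z s) ≈ 0# → sum (λ s → g s ⊛ z s) ≈ 0# → sum (λ s → h s ⊛ z s) ≈ 0#
  sum-combine a f g h z h≈ fz≈0 gz≈0 = begin
    sum (λ s → h s ⊛ z s)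
      ≈⟨ sum-cong-≋ {x = λ s → h s ⊛ z s} {y = λ s → (a ⊛ f s ⊕ - 1# ⊛ g s) ⊛ z s}
           (λ s → *-congʳ (trans (h≈ s) (+-congˡ (sym (-1*x≈-x (g s)))))) ⟩
    sum (λ s → (a ⊛ f s ⊕ - 1# ⊛ g s) ⊛ z s)
      ≈⟨ sum-linear a (- 1#) f g z ⟩
    a ⊛ sum (λ s → f s ⊛ z s) ⊕ - 1# ⊛ sum (λ s → g s ⊛ z s)
      ≈⟨ +-cong (trans (*-congˡ fz≈0) (zeroʳ a)) (trans (*-congˡ gz≈0) (zeroʳ _)) ⟩
    0# ⊕ 0#
      ≈⟨ +-identityˡ 0# ⟩
    0# ∎

  -- A contraction is linear in the row of `A` it uses, and skew-symmetry turns the relation among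
  -- columns into one among rows.
  ∂-kernel : ∀ {r} (col : Fin r → V) x → (∀ row → sum (λ t → A row (col t) ⊛ x t) ≈ 0#) →
    ∀ φ L → sum (λ t → ∂ (col t) φ L ⊛ x t) ≈ 0#
  ∂-kernel col x Ax≈0 φ []      = sum-zero (λ t → 0# ⊛ x t) λ t → zeroˡ (x t)
  ∂-kernel col x Ax≈0 φ (y ∷ L) =
    sum-combine (φ L) (λ t → A (col t) y) (λ t → ∂ (col t) (φ ∘ (y ∷_)) L) (λ t → ∂ (col t) φ (y ∷ L)) x
      (λ t → +-congʳ (*-comm _ _))
      (trans (sum-neg (λ t → A (col t) y ⊛ x t) (λ t → A y (col t) ⊛ x t)
                      (λ t → trans (*-congʳ (skew (col t) y)) (sym (-‿distribˡ-* _ _))))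
             (trans (-‿cong (Ax≈0 y)) -0#≈0#))
      (∂-kernel col x Ax≈0 (φ ∘ (y ∷_)) L)

  -- Up to sign, the factor of `A row (lookup L u)` in `∂ row φ L`. It is independent of `row`, so a
  -- combination that kills these factors kills the contractions with every row.
  delete : Form → (L : List V) → Fin (length L) → Carrier
  delete φ (y ∷ L) zero    = φ L
  delete φ (y ∷ L) (suc u) = delete (φ ∘ (y ∷_)) L u

  ∂-combination : ∀ {r} (φ : Fin r → Form) z L →
    (∀ u → sum (λ s → delete (φ s) L u ⊛ z s) ≈ 0#) →
    ∀ row → sum (λ s → ∂ row (φ s) L ⊛ z s) ≈ 0#
  ∂-combination φ z []      hyp row = sum-zero (λ s → 0# ⊛ z s) λ s → zeroˡ (z s)
  ∂-combination φ z (y ∷ L) hyp row =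
    sum-combine (A row y) (λ s → φ s L) (λ s → ∂ row (φ s ∘ (y ∷_)) L) (λ s → ∂ row (φ s) (y ∷ L)) z
      (λ _ → ≈-refl) (hyp zero) (∂-combination (λ s → φ s ∘ (y ∷_)) z L (hyp ∘ suc) row)

  -- Cramer's rule: if A x = 0 then expanding Pf (v, I∖s) along v = I t and summing over t kills
  -- every term with t ≠ s, since there the index I t is repeated.
  Pf-independent : ∀ h I → Unique I → ¬ (Pf h I ≈ 0#) → LinIndepCols F A (lookup I)
  Pf-independent zero    (_ ∷ _) u Pf≉0 = contradiction ≈-refl Pf≉0
  Pf-independent zero    []      u Pf≉0 x Ax≈0 ()
  Pf-independent (suc h) I       u Pf≉0 x Ax≈0 s with ∈-∃++ (∈-lookup {xs = I} s)
  ... | P , Q , I≡ = cancel-nonzero (Pf≉0 ∘ ↭-zero {Pf (suc h)} (Pf-alternating (suc h)) I↭) (begin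
      ∂ (lookup I s) (Pf h) (P ++ Q) ⊛ x s
        ≈⟨ sum-single (λ t → ∂ (lookup I t) (Pf h) (P ++ Q) ⊛ x t) s others ⟨
      sum (λ t → ∂ (lookup I t) (Pf h) (P ++ Q) ⊛ x t)
        ≈⟨ ∂-kernel (lookup I) x Ax≈0 (Pf h) (P ++ Q) ⟩
      0# ∎)
    where
    I↭ : I ↭ lookup I s ∷ P ++ Q
    I↭ = ↭-trans (↭-reflexive I≡) (shift _ P Q)

    others : ∀ t → t ≢ s → ∂ (lookup I t) (Pf h) (P ++ Q) ⊛ x t ≈ 0#
    others t t≢s = trans (*-congʳ (repeat-zero {Pf (suc h)} (lookup I t ∷ P ++ Q) (Pf-alternating (suc h))
                     (λ u′ → head∉tail u′ It∈))) (zeroˡ _)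
      where
      It∈ : lookup I t ∈ P ++ Q
      It∈ with ∈-resp-↭ I↭ (∈-lookup {xs = I} t)
      ... | here eq  = contradiction (lookup-injective u eq) t≢s
      ... | there ∈′ = ∈′

  -- Vanishing of Pf (j, i, I) expresses A j i · Pf I through the entries A j (I u), uniformly in j.
  Pf-spanning : ∀ h I → ¬ (Pf h I ≈ 0#) → (∀ j i → Pf (suc h) (j ∷ i ∷ I) ≈ 0#) →
    ∀ (col : Fin (suc (length I)) → V) → ¬ LinIndepCols F A col
  Pf-spanning h I Pf≉0 bordered≈0 col indep =
    -- The deletions form a matrix with one more column than rows; independence of `col` would give
    -- it a trivial kernel.
    wide-kernel (length I) (λ u s → delete (φ s) I u) λ z Cz≈0 → indep z λ row → cancel-nonzero Pf≉0 (begin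
      Pf h I ⊛ sum (λ s → A row (col s) ⊛ z s)
        ≈⟨ *-distribˡ-sum (Pf h I) (λ s → A row (col s) ⊛ z s) ⟩
      sum (λ s → Pf h I ⊛ (A row (col s) ⊛ z s))
        ≈⟨ sum-cong-≋ {x = λ s → Pf h I ⊛ (A row (col s) ⊛ z s)} {y = λ s → ∂ row (φ s) I ⊛ z s}
             (λ s → trans (sym (*-assoc _ _ _)) (*-congʳ (trans (*-comm _ _) (expand row s)))) ⟩
      sum (λ s → ∂ row (φ s) I ⊛ z s)
        ≈⟨ ∂-combination φ z I Cz≈0 row ⟩
      0# ∎)
    where
    φ : Fin (suc (length I)) → Form
    φ s = Pf h ∘ (col s ∷_)

    expand : ∀ row s → A row (col s) ⊛ Pf h I ≈ ∂ row (φ s) I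
    expand row s = x∙y⁻¹≈ε⇒x≈y _ _ (bordered≈0 row (col s))

-- The rank of a matrix of a graph without even cycles

module Rank {c ℓ} (F : Field c ℓ) (char≢2 : CharNot2 F) (G : Graph) (none : NoEvenCycle G) where
  open Field F hiding (zero; _+_; _*_; refl)
  open Field F using () renaming (_+_ to infixl 6 _⊕_; _*_ to infixl 7 _⊛_; refl to ≈-refl)
  open Graph G using (n; adj)
  open LinearAlgebra F
  open Matchings G
  open RingProperties ring using (-0#≈0#; -‿involutive)

  module _ (A : Matrix F n) (A∈S : InSminus F G A) where
    open Pfaffian F char≢2 A (proj₁ A∈S) hiding (V)

    ZeroOffEdges : Set ℓ
    ZeroOffEdges = ∀ i j → ¬ (i ─ j) → A i j ≈ 0#

    zero-off-edges : ¬ ¬ ZeroOffEdges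
    zero-off-edges = ¬¬-Π n λ i → ¬¬-Π n (entry i)
      where
      entry : ∀ i j → ¬ ¬ (¬ (i ─ j) → A i j ≈ 0#)
      entry i j k with i ≟ j
      ... | yes refl = k λ _ → diagonal i
      -- Were the entry zero, `k` would already be contradicted; so it is nonzero and yields the
      -- edge that `¬e` forbids.
      ... | no i≢j   = k λ ¬e → contradiction (proj₁ (proj₂ A∈S i j i≢j) λ Aij≈0 → k λ _ → Aij≈0) ¬e

    -- In each term either `x` and `w` are not adjacent, or that edge would complete a perfect
    -- matching of the remaining list to one of the whole.
    Pf-unmatched : ZeroOffEdges → ∀ h L → ¬ Matched h L → Pf h L ≈ 0#
    Pf-unmatched off zero    []      ¬M = contradiction nil ¬M
    Pf-unmatched off zero    (_ ∷ _) ¬M = ≈-refl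
    Pf-unmatched off (suc h) []      ¬M = ≈-refl
    Pf-unmatched off (suc h) (x ∷ L) ¬M = ∂-vanish x (Pf h) L term
      where
      term : ∀ P w Q → L ≡ P ++ w ∷ Q → A x w ⊛ Pf h (P ++ Q) ≈ 0#
      term P w Q refl with adj x w Bool.≟ true
      ... | no ¬e = trans (*-congʳ (off x w ¬e)) (zeroˡ _)
      ... | yes e = trans (*-congˡ (Pf-unmatched off h (P ++ Q) λ M → ¬M (pair e M (prep x (shift w P Q)))))
                          (zeroʳ _)

    -- In the expansion along x only the partner z of x survives: a perfect matching using another
    -- edge x w would differ from the given one, and their union would contain an even cycle.
    Pf-matched : ZeroOffEdges → ∀ {h I} → Matched h I → Unique I → ¬ (Pf h I ≈ 0#)
    Pf-matched off nil U = 1≉0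
    Pf-matched off {suc h} {I} (pair {x = x} {z} {R} e M I↭) U Pf≈0 with unique-resp-↭ I↭ U
    ... | U′@(_ ∷ U″@(_ ∷ U‴)) = ⊛-nonzero (proj₂ (proj₂ A∈S x z x≢z) e) (Pf-matched off M U‴) (begin
        A x z ⊛ Pf h R
          ≈⟨ +-identityʳ _ ⟨
        A x z ⊛ Pf h R ⊕ 0#
          ≈⟨ +-congˡ (trans (-‿cong (∂-vanish x (Pf h ∘ (z ∷_)) R other)) -0#≈0#) ⟨
        Pf (suc h) (x ∷ z ∷ R)
          ≈⟨ ↭-zero {Pf (suc h)} (Pf-alternating (suc h)) (↭-sym I↭) Pf≈0 ⟩
        0# ∎)
      where
      open SetoidReasoning setoid

      x≢z : x ≢ z
      x≢z refl = no-loop e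

      other : ∀ P w Q → R ≡ P ++ w ∷ Q → A x w ⊛ Pf h (z ∷ P ++ Q) ≈ 0#
      other P w Q refl with adj x w Bool.≟ true
      ... | no ¬e = trans (*-congʳ (off x w ¬e)) (zeroˡ _)
      ... | yes e′ = trans (*-congˡ (Pf-unmatched off h (z ∷ P ++ Q) unmatched)) (zeroʳ _)
        where
        unmatched : ¬ Matched h (z ∷ P ++ Q)
        -- Both matchings are carried to the list `x ∷ z ∷ R`; they differ at `x`, because `w` lies
        -- in `R` and `z` does not.
        unmatched M′ with pair⇒mate e M ↭-refl U′
                        | pair⇒mate e′ M′ (prep x (shift w (z ∷ P) Q)) U′
        ... | N , Nx≡z | N′ , N′x≡w = Alternating.even-cycle N N′ (here refl)
          (λ eq → head∉tail U″ (subst (_∈ R) (≡.trans (≡.sym N′x≡w) (≡.trans (≡.sym eq) Nx≡z))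
                                             (∈-++⁺ʳ P (here refl)))) none

    matched-rank : ∀ {k I} → Matched k I → Unique I → (∀ m → HasMatching G m → m ≤ k) →
      HasRank F A (length I)
    matched-rank {k} {I} M U max =
        (lookup I , lookup-injective U , Pf-independent k I U Pf≉0)
      , λ col _ indep → zero-off-edges λ off → Pf-spanning k I Pf≉0 (bordered off) col indep
      where
      Pf≉0 : ¬ (Pf k I ≈ 0#)
      Pf≉0 Pf≈0 = zero-off-edges λ off → Pf-matched off M U Pf≈0

      -- A repeated index gives zero by alternation; otherwise a perfect matching of the list would
      -- have `suc k` edges, exceeding `max`.
      bordered : ZeroOffEdges → ∀ j i → Pf (suc k) (j ∷ i ∷ I) ≈ 0#
      bordered off j i with allPairs? (λ x y → ¬? (x ≟ y)) (j ∷ i ∷ I)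
      ... | no ¬U′ = repeat-zero {Pf (suc k)} (j ∷ i ∷ I) (Pf-alternating (suc k)) ¬U′
      ... | yes U′ = Pf-unmatched off (suc k) (j ∷ i ∷ I) λ M′ →
        contradiction (max (suc k) (matched⇒matching M′ U′)) (ℕ.<-irrefl refl)

  -- A matrix with the given graph

  sign : Fin n → Fin n → Carrier
  sign i j with Fin.<-cmp i j
  ... | tri< _ _ _ = 1#
  ... | tri≈ _ _ _ = 0#
  ... | tri> _ _ _ = - 1#

  sign-skew : ∀ i j → sign i j ≈ - sign j i
  sign-skew i j with Fin.<-cmp i j | Fin.<-cmp j i
  ... | tri< _ _ _   | tri> _ _ _   = sym (-‿involutive 1#)
  ... | tri≈ _ _ _   | tri≈ _ _ _   = sym -0#≈0#
  ... | tri> _ _ _   | tri< _ _ _   = ≈-refl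
  ... | tri< _ _ j≮i | tri< j<i _ _ = contradiction j<i j≮i
  ... | tri< _ i≢j _ | tri≈ _ j≡i _ = contradiction (≡.sym j≡i) i≢j
  ... | tri≈ _ i≡j _ | tri< _ j≢i _ = contradiction (≡.sym i≡j) j≢i
  ... | tri≈ _ i≡j _ | tri> _ j≢i _ = contradiction (≡.sym i≡j) j≢i
  ... | tri> _ i≢j _ | tri≈ _ j≡i _ = contradiction (≡.sym j≡i) i≢j
  ... | tri> i≮j _ _ | tri> _ _ i<j = contradiction i<j i≮j

  sign-nonzero : ∀ i j → i ≢ j → ¬ (sign i j ≈ 0#)
  sign-nonzero i j i≢j with Fin.<-cmp i j
  ... | tri< _ _ _   = 1≉0
  ... | tri≈ _ i≡j _ = contradiction i≡j i≢j
  ... | tri> _ _ _   = λ -1≈0 → 1≉0 (trans (sym (-‿involutive 1#)) (trans (-‿cong -1≈0) -0#≈0#))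

  -- The skew-adjacency matrix with edges directed from smaller to larger index; it supplies a
  -- matrix attaining the extremal ranks.
  orientation : Matrix F n
  orientation i j = if adj i j then sign i j else 0#

  orientation∈S : InSminus F G orientation
  orientation∈S = skew , λ i j i≢j → support i j , nonzero i j i≢j
    where
    skew : ∀ i j → orientation i j ≈ - orientation j i
    skew i j rewrite Graph.sym G j i with adj i j
    ... | true  = sign-skew i j
    ... | false = sym -0#≈0#

    support : ∀ i j → ¬ (orientation i j ≈ 0#) → i ─ j
    support i j ≉0 with adj i j
    ... | true  = refl
    ... | false = contradiction ≈-refl ≉0

    nonzero : ∀ i j → i ≢ j → i ─ j → ¬ (orientation i j ≈ 0#)
    nonzero i j i≢j e rewrite e = sign-nonzero i j i≢j

theorem3p3 : ∀ {c ℓ : Level} (F : Field c ℓ) → CharNot2 F →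
    (G : Graph) → Connected G → NoEvenCycle G →
    Σ ℕ λ k → IsMatchingNumber G k × IsMinRank F G (2 * k) × IsMaxRank F G (2 * k)
theorem3p3 F char≢2 G _ none with Matchings.matching-number G
... | k , matching , max with Matchings.matching⇒matched G matching
...   | I , M , U =
      -- Every matrix of the graph has rank `2 * k`, so one witness serves both extremes and
      -- comparing ranks gives both bounds.
      k , (matching , max)
    , ((orientation , orientation∈S , rank orientation orientation∈S) ,
       λ A r A∈S → rank-≤ A (rank A A∈S))
    , ((orientation , orientation∈S , rank orientation orientation∈S) ,
       λ A r A∈S A-rank → rank-≤ A A-rank (rank A A∈S))
    where
    open Rank F char≢2 G none
    open LinearAlgebra F using (rank-≤)

    rank : ∀ A → InSminus F G A → HasRank F A (2 * k)
    rank A A∈S = subst (HasRank F A) (Matchings.matched-length G M) (matched-rank A A∈S M U max)
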